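{- Let \(n\) be a nonnegative integer, let \(A\) and \(B\) be subsets of \(\{0,1,\ldots,n\}\) of equal size, and let \(A^\mathsf{c}\) and \(B^\mathsf{c}\) be their complements in \(\{0,1,\ldots,n\}\). Let \(\alpha\) and \(\beta\) be partitions with \(n\) parts (with parts equal to \(0\) permitted) such that \(\alpha_i \leq \beta_i\) for all \(i\). Suppose that for all \(a' \in A^\mathsf{c}\) and \(b' \in B^\mathsf{c}\), either: (i) \(a' - b' \leq 0\); or (ii) \(a' - b' > \beta_{b'+1} - \alpha_{a'}\); or (iii) for all \(i\) such that \(b'+1 \leq i \leq a'\), we have \(\alpha_{i} - \alpha_{a'} \leq a'-i\) and \(\beta_{b'+1} - \beta_i \leq i-b'-1\). Then the determinants \[ \det\Bigl( h_{b - a} (x_{\alpha_{a+1}+1}, x_{\alpha_{a+1}+2}, \ldots, x_{\beta_{b}}) \Bigr)_{a \in A, b \in B} \] and \[ \det\Bigl( e_{a' - b'} (x_{\alpha_{a'}+1}, x_{\alpha_{a'}+2}, \ldots, x_{\beta_{b'+1}}) \Bigr)_{a' \in A^\mathsf{c}, b' \in B^\mathsf{c}} \] are equal.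
   Context: Here \(h_i\) and \(e_i\) denote the complete homogeneous and elementary symmetric polynomials of degree \(i\), with the conventions \(e_0 = h_0 = 1\) and \(e_d = h_d = 0\) for \(d < 0\); symmetric polynomials of positive degree in an empty set of variables are \(0\). Finite subsets of \(\mathbb{Z}\) used to index matrix rows and columns are ordered from smallest to largest element. Where needed, \(\alpha_{n+1}\) is interpreted as \(\alpha_n\) and \(\beta_0\) as \(\beta_1\). -}

module Defs where

open import Level using (Level)
open import Algebra.Bundles using (CommutativeRing)
open import Data.Bool using (Bool; true; false)
open import Data.Nat as ℕ using (ℕ; zero; suc; _∸_)
open import Data.Nat.Properties using (m⊓n≤n)
open import Data.Integer as ℤ using (ℤ; +_; -[1+_])
open import Data.Fin using (Fin; zero; suc; toℕ; fromℕ<)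
open import Data.Fin.Subset using (Subset)
open import Data.List using (List; []; _∷_; map)
open import Data.Vec using (Vec; []; _∷_)

-- The ground set {0,1,…,n} is Fin (suc n); subsets are Data.Fin.Subset.

elems : {m : ℕ} → Subset m → List (Fin m)
elems [] = []
elems (true ∷ s) = zero ∷ map suc (elems s)
elems (false ∷ s) = map suc (elems s)

-- Accessor for a sequence of n parts α₁,…,αₙ (stored as α : Fin n → ℕ,
-- with α zero = α₁) at an arbitrary natural index i, clamped into 1..n.
-- So part α 0 = α₁ (this realises β₀ := β₁), part α (n+1) = αₙ
-- (this realises α_{n+1} := αₙ).  For n = 0 every value is 0.
part : {n : ℕ} → (Fin n → ℕ) → ℕ → ℕ
part {zero} α i = 0
part {suc m} α i = α (fromℕ< (ℕ.s≤s (m⊓n≤n (i ∸ 1) m)))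

IsPartition : {n : ℕ} → (Fin n → ℕ) → Set
IsPartition {n} α = (i j : Fin n) → toℕ i ℕ.≤ toℕ j → α j ℕ.≤ α i

module _ {c ℓ : Level} (R : CommutativeRing c ℓ) where
  open CommutativeRing R

  eₙ : ℕ → List Carrier → Carrier
  eₙ zero    _        = 1#
  eₙ (suc k) []       = 0#
  eₙ (suc k) (y ∷ ys) = eₙ (suc k) ys + y * eₙ k ys

  hₙ : ℕ → List Carrier → Carrier
  hₙ zero    _        = 1#
  hₙ (suc k) []       = 0#
  hₙ (suc k) (y ∷ ys) = hₙ (suc k) ys + y * hₙ k (y ∷ ys)

  e : ℤ → List Carrier → Carrier
  e (+ k)      ys = eₙ k ys
  e -[1+ _ ]   ys = 0#

  h : ℤ → List Carrier → Carrier
  h (+ k)      ys = hₙ k ys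
  h -[1+ _ ]   ys = 0#

  vars : (ℕ → Carrier) → ℕ → ℕ → List Carrier
  vars x p q = go (q ∸ p)
    where
    go : ℕ → List Carrier
    go zero    = []
    go (suc k) = x (ℕ._+_ p (suc k)) ∷ go k

  -- determinant of the minor with rows rs and columns cs (both lists,
  -- in the given order) of the matrix M, by Laplace expansion along the
  -- first row.  (Only used with length rs = length cs.)
  det : {I J : Set} → (I → J → Carrier) → List I → List J → Carrier
  det M []       []       = 1#
  det M []       (_ ∷ _)  = 0#
  det M (r ∷ rs) cs       = expand 1# [] cs
    where
    -- sign, columns already passed (stored reversed), remaining columns
    expand : Carrier → List _ → List _ → Carrier
    expand s pre []       = 0#
    expand s pre (c ∷ post) =
      s * M r c * det M rs (revApp pre post) + expand (- s) (c ∷ pre) post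
      where
      revApp : List _ → List _ → List _
      revApp []       ys = ys
      revApp (z ∷ zs) ys = revApp zs (z ∷ ys)

{-# OPTIONS --safe #-}
-- Both matrices are minors of (n+1)×(n+1) unitriangular ones.  Let H have the entries
-- h_{b-a} of the theorem, and let G(c,b) be the sum of x(t₁) ⋯ x(tₖ), k = b - c, over
-- t₁ > ⋯ > tₖ with α(c+i) < tᵢ ≤ β(c+i).  In H(a,c) G(c,b), moving the largest factor
-- from one side to the other (summation by parts) shows
-- H(a,c) G(c,b) = K(c) + K(c+1), so Σ_c (-1)^c H(a,c) G(c,b) telescopes to 0 for a < b and
-- the inverse of H is ((-1)^{b-c} G(c,b)).  Jacobi's complementary minor theorem turns the
-- first determinant into the minor of the transpose of G on Aᶜ × Bᶜ, the signs cancelling.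
-- There (i)–(iii) make each entry of G equal to e_{a'-b'}: under (iii) the bounds on the
-- inner tᵢ follow from those on the outer two, and under (ii) both sides vanish.
module Submission where

open import Defs
open import Level using (Level)
open import Algebra.Bundles using (CommutativeRing)
open import Data.Bool using (true; false)
open import Data.Nat using (ℕ; zero; suc; z≤n; s≤s; _∸_; _⊓_)
open import Data.Integer using (ℤ; +_; -[1+_]; _-_; _≤_; _<_; +≤+; +<+)
open import Data.Fin using (Fin; zero; suc; toℕ)
open import Data.Fin.Subset using (Subset; ∁; ∣_∣; _∈_)
open import Data.Nat as ℕ using ()
open import Data.Sum using (_⊎_; inj₁; inj₂)
open import Data.Product using (_×_; _,_; proj₁; proj₂)
open import Relation.Binary.PropositionalEquality using (_≡_)

import Algebra.Properties.Ring as RingProperties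
import Data.Fin as Fin
import Data.Integer as ℤ
import Data.Integer.Properties as ℤ
import Data.Nat.Properties as ℕ
import Relation.Binary.PropositionalEquality as ≡
import Relation.Binary.Reasoning.Setoid as SetoidReasoning
open import Data.Fin.Properties using (toℕ-fromℕ<; toℕ<n)
open import Data.Integer.Solver using (module +-*-Solver)
open import Data.List using (List; []; _∷_; _++_; map; length; _ʳ++_)
open import Data.List.Properties using (map-++)
open import Data.List.Relation.Unary.All as All using (All; []; _∷_)
open import Data.List.Relation.Unary.All.Properties using (map⁺)
open import Data.Unit using (⊤; tt)
open import Data.Vec using ([]; _∷_; here; there)
open import Function using (_∘_; flip; id)
open import Relation.Binary.Definitions using (tri<; tri≈; tri>)
open import Relation.Nullary using (yes; no; contradiction)

-- Integer inequalities and clamped indices.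

private
  [a+i]-a≡i : ∀ a i → + (a ℕ.+ i) - + a ≡ + i
  [a+i]-a≡i a i = ≡.trans (ℤ.m-n≡m⊖n (a ℕ.+ i) a)
    (≡.trans (ℤ.⊖-≥ (ℕ.m≤m+n a i)) (≡.cong +_ (ℕ.m+n∸m≡n a i)))

  [1+a+i]-a≡1+i : ∀ a i → + suc (a ℕ.+ i) - + a ≡ + suc i
  [1+a+i]-a≡1+i a i = ≡.trans (≡.cong (λ z → + z - + a) (≡.sym (ℕ.+-suc a i))) ([a+i]-a≡i a (suc i))

  m<n⇒m-n<0 : ∀ {m n} → m ℕ.< n → + m - + n < + 0
  m<n⇒m-n<0 {m} {n} m<n =
    ≡.subst (+ m - + n <_) (ℤ.+-inverseʳ (+ n)) (ℤ.+-monoˡ-< (ℤ.- + n) (+<+ m<n))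

  cross : ∀ m n k → (m - n) ℤ.+ (n ℤ.+ k) ≡ m ℤ.+ k
  cross = solve 3 (λ m n k → (m :- n) :+ (n :+ k) := m :+ k) ≡.refl
    where open +-*-Solver

  cross′ : ∀ m n k → (m - n) ℤ.+ (k ℤ.+ n) ≡ k ℤ.+ m
  cross′ = solve 3 (λ m n k → (m :- n) :+ (k :+ n) := k :+ m) ≡.refl
    where open +-*-Solver

  -- Adding `n + l` to both sides clears the subtractions, so that conditions on the parts become
  -- bounds between natural numbers.
  m-n≤k-l⇒m+l≤n+k : ∀ m n k l → + m - + n ≤ + k - + l → m ℕ.+ l ℕ.≤ n ℕ.+ k
  m-n≤k-l⇒m+l≤n+k m n k l p = ℤ.drop‿+≤+ (≡.subst₂ _≤_
    (cross (+ m) (+ n) (+ l)) (cross′ (+ k) (+ l) (+ n)) (ℤ.+-monoˡ-≤ (+ n ℤ.+ + l) p))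

  m-n<k-l⇒m+l<n+k : ∀ m n k l → + m - + n < + k - + l → m ℕ.+ l ℕ.< n ℕ.+ k
  m-n<k-l⇒m+l<n+k m n k l p = ℤ.drop‿+<+ (≡.subst₂ _<_
    (cross (+ m) (+ n) (+ l)) (cross′ (+ k) (+ l) (+ n)) (ℤ.+-monoˡ-< (+ n ℤ.+ + l) p))

  i-m-1≡i-[1+m] : ∀ i m → i - + m - + 1 ≡ i - + suc m
  i-m-1≡i-[1+m] i m = solve 2 (λ i m → i :- m :- con (+ 1) := i :- (con (+ 1) :+ m)) ≡.refl i (+ m)
    where open +-*-Solver

  -- Clamping the index is monotone, so the conventions at indices `0` and `n + 1` keep the sequence
  -- weakly decreasing.
  part-antitone : ∀ {n} {α : Fin n → ℕ} → IsPartition α → ∀ {i j} → i ℕ.≤ j → part α j ℕ.≤ part α i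
  part-antitone {zero}  αp i≤j = z≤n
  part-antitone {suc n} αp {i} {j} i≤j = αp _ _ (≡.subst₂ ℕ._≤_
    (≡.sym (toℕ-fromℕ< (s≤s (ℕ.m⊓n≤n (i ∸ 1) n)))) (≡.sym (toℕ-fromℕ< (s≤s (ℕ.m⊓n≤n (j ∸ 1) n))))
    (ℕ.⊓-monoˡ-≤ n (ℕ.∸-monoˡ-≤ 1 i≤j)))

  elems-∈ : ∀ {m} (S : Subset m) → All (_∈ S) (elems S)
  elems-∈ []          = []
  elems-∈ (true ∷ S)  = here ∷ map⁺ (All.map there (elems-∈ S))
  elems-∈ (false ∷ S) = map⁺ (All.map there (elems-∈ S))

module _ {c ℓ : Level} (R : CommutativeRing c ℓ) where
  open CommutativeRing R hiding (_-_; zero)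
  open RingProperties ring
  open SetoidReasoning setoid

  -- Subtraction and alternating sums in a commutative ring.

  infixl 6 _⊝_
  _⊝_ : Carrier → Carrier → Carrier
  u ⊝ v = u + - v

  ⊝-cong : ∀ {u u′ v v′} → u ≈ u′ → v ≈ v′ → u ⊝ v ≈ u′ ⊝ v′
  ⊝-cong p q = +-cong p (-‿cong q)

  ⊝-identityʳ : ∀ u → u ⊝ 0# ≈ u
  ⊝-identityʳ u = trans (+-congˡ -0#≈0#) (+-identityʳ u)

  neg-⊝ : ∀ u v → - (u ⊝ v) ≈ v ⊝ u
  neg-⊝ u v = trans (sym (-‿+-comm u (- v)))
    (trans (+-congˡ (-‿involutive v)) (+-comm (- u) v))

  *-⊝ : ∀ s u v → s * (u ⊝ v) ≈ s * u ⊝ s * v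
  *-⊝ s u v = trans (distribˡ s u (- v)) (+-congˡ (sym (-‿distribʳ-* s v)))

  ⊝-⊝-interchange : ∀ u v s t → (u ⊝ v) ⊝ (s ⊝ t) ≈ (u ⊝ s) ⊝ (v ⊝ t)
  ⊝-⊝-interchange u v s t = begin
    (u + - v) + - (s + - t)     ≈⟨ +-congˡ (-‿+-comm s (- t)) ⟨
    (u + - v) + (- s + - - t)   ≈⟨ interchange u (- v) (- s) (- - t) ⟩
    (u + - s) + (- v + - - t)   ≈⟨ +-congˡ (-‿+-comm v (- t)) ⟩
    (u + - s) + - (v + - t)     ∎
    where
    interchange : ∀ a b d f → (a + b) + (d + f) ≈ (a + d) + (b + f)
    interchange a b d f = begin
      (a + b) + (d + f)  ≈⟨ +-assoc a b (d + f) ⟩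
      a + (b + (d + f))  ≈⟨ +-congˡ (trans (sym (+-assoc b d f)) (trans (+-congʳ (+-comm b d)) (+-assoc d b f))) ⟩
      a + (d + (b + f))  ≈⟨ +-assoc a d (b + f) ⟨
      (a + d) + (b + f)  ∎

  *-leftComm : ∀ u v w → u * (v * w) ≈ v * (u * w)
  *-leftComm u v w = trans (sym (*-assoc u v w)) (trans (*-congʳ (*-comm u v)) (*-assoc v u w))

  -- Nested subtraction yields the signs `(-1)^k` without powers of `-1` and follows the recursion
  -- of `contract`.
  altsum : ∀ {m} → (Fin m → Carrier) → Carrier
  altsum {zero}  f = 0#
  altsum {suc m} f = f zero ⊝ altsum (f ∘ suc)

  altsum-cong : ∀ {m} {f g : Fin m → Carrier} → (∀ k → f k ≈ g k) → altsum f ≈ altsum g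
  altsum-cong {zero}  p = refl
  altsum-cong {suc m} p = ⊝-cong (p zero) (altsum-cong (p ∘ suc))

  altsum-0 : ∀ {m} {f : Fin m → Carrier} → (∀ k → f k ≈ 0#) → altsum f ≈ 0#
  altsum-0 {zero}  p = refl
  altsum-0 {suc m} p = trans (⊝-cong (p zero) (altsum-0 (p ∘ suc))) (⊝-identityʳ 0#)

  altsum-⊝ : ∀ {m} (f g : Fin m → Carrier) → altsum f ⊝ altsum g ≈ altsum (λ k → f k ⊝ g k)
  altsum-⊝ {zero}  f g = ⊝-identityʳ 0#
  altsum-⊝ {suc m} f g = trans (⊝-⊝-interchange _ _ _ _) (⊝-cong refl (altsum-⊝ (f ∘ suc) (g ∘ suc)))

  altsum-neg : ∀ {m} (f : Fin m → Carrier) → altsum (λ k → - f k) ≈ - altsum f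
  altsum-neg {zero}  f = sym -0#≈0#
  altsum-neg {suc m} f = trans (+-congˡ (-‿cong (altsum-neg (f ∘ suc)))) (-‿+-comm _ _)

  altsum-*ˡ : ∀ {m} u (f : Fin m → Carrier) → u * altsum f ≈ altsum (λ k → u * f k)
  altsum-*ˡ {zero}  u f = zeroʳ u
  altsum-*ˡ {suc m} u f = trans (*-⊝ u _ _) (⊝-cong refl (altsum-*ˡ u (f ∘ suc)))

  -- Neighbouring terms share `K (suc k)` with opposite signs; what survives is `K 0` and, up to
  -- sign, `K m`.
  altsum-telescope : ∀ (K : ℕ → Carrier) m → K m ≈ 0# →
    altsum {m} (λ k → K (toℕ k) + K (suc (toℕ k))) ≈ K 0
  altsum-telescope K zero    Km≈0 = sym Km≈0
  altsum-telescope K (suc m) Km≈0 = begin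
    (K 0 + K 1) ⊝ altsum {m} _  ≈⟨ ⊝-cong refl (altsum-telescope (K ∘ suc) m Km≈0) ⟩
    (K 0 + K 1) ⊝ K 1           ≈⟨ +-assoc _ _ _ ⟩
    K 0 + (K 1 ⊝ K 1)           ≈⟨ +-congˡ (-‿inverseʳ _) ⟩
    K 0 + 0#                    ≈⟨ +-identityʳ _ ⟩
    K 0                         ∎

  -- Determinants as iterated contractions: alternation and multilinearity.

  -- Interior product of the covector w with the multilinear form F; the first-row
  -- expansion of a determinant is the special case used in D.
  contract : {J : Set} → (J → Carrier) → (List J → Carrier) → List J → Carrier
  contract w F []       = 0#
  contract w F (c ∷ cs) = w c * F cs ⊝ contract w (λ ds → F (c ∷ ds)) cs

  -- The determinant without the sign and column accumulators of `det`, which makes it accessible to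
  -- induction on the rows; `det≈D` identifies the two.
  D : {I J : Set} → (I → J → Carrier) → List I → List J → Carrier
  D M []       []       = 1#
  D M []       (_ ∷ _)  = 0#
  D M (r ∷ rs)          = contract (M r) (D M rs)

  module _ {J : Set} where

    contract-cong : {P : J → Set} {w w′ : J → Carrier} {F F′ : List J → Carrier} →
      (∀ {j} → P j → w j ≈ w′ j) → (∀ {cs} → All P cs → F cs ≈ F′ cs) →
      ∀ {cs} → All P cs → contract w F cs ≈ contract w′ F′ cs
    contract-cong p q []         = refl
    contract-cong p q (pc ∷ pcs) =
      ⊝-cong (*-cong (p pc) (q pcs)) (contract-cong p (λ pds → q (pc ∷ pds)) pcs)

    contract-congʳ : ∀ {w} {F F′ : List J → Carrier} → (∀ cs → F cs ≈ F′ cs) →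
      ∀ cs → contract w F cs ≈ contract w F′ cs
    contract-congʳ q cs =
      contract-cong {P = λ _ → ⊤} (λ _ → refl) (λ {ds} _ → q ds) (All.universal (λ _ → tt) cs)

    contract-0ˡ : ∀ {w} {F : List J → Carrier} → (∀ j → w j ≈ 0#) → ∀ cs → contract w F cs ≈ 0#
    contract-0ˡ p []       = refl
    contract-0ˡ p (c ∷ cs) =
      trans (⊝-cong (trans (*-congʳ (p c)) (zeroˡ _)) (contract-0ˡ p cs)) (⊝-identityʳ 0#)

    contract-0ʳ : ∀ {w} {F : List J → Carrier} → (∀ cs → F cs ≈ 0#) → ∀ cs → contract w F cs ≈ 0#
    contract-0ʳ p []       = refl
    contract-0ʳ p (c ∷ cs) =
      trans (⊝-cong (trans (*-congˡ (p cs)) (zeroʳ _)) (contract-0ʳ (λ ds → p (c ∷ ds)) cs)) (⊝-identityʳ 0#)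

    contract-neg : ∀ {w} (F : List J → Carrier) cs → contract w (λ ds → - F ds) cs ≈ - contract w F cs
    contract-neg F []       = sym -0#≈0#
    contract-neg F (c ∷ cs) =
      trans (+-cong (sym (-‿distribʳ-* _ _)) (-‿cong (contract-neg (λ ds → F (c ∷ ds)) cs))) (-‿+-comm _ _)

    contract-altsum : ∀ {m w} (u : Fin m → Carrier) (F : Fin m → List J → Carrier) cs →
      contract w (λ ds → altsum (λ k → u k * F k ds)) cs ≈ altsum (λ k → u k * contract w (F k) cs)
    contract-altsum u F [] = sym (altsum-0 (λ k → zeroʳ (u k)))
    contract-altsum {w = w} u F (c ∷ cs) = begin
      w c * altsum (λ k → u k * F k cs) ⊝ contract w (λ ds → altsum (λ k → u k * F k (c ∷ ds))) cs
        ≈⟨ ⊝-cong (altsum-*ˡ (w c) (λ k → u k * F k cs)) (contract-altsum u (λ k ds → F k (c ∷ ds)) cs) ⟩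
      altsum (λ k → w c * (u k * F k cs)) ⊝ altsum (λ k → u k * contract w (λ ds → F k (c ∷ ds)) cs)
        ≈⟨ altsum-⊝ (λ k → w c * (u k * F k cs)) _ ⟩
      altsum (λ k → w c * (u k * F k cs) ⊝ u k * contract w (λ ds → F k (c ∷ ds)) cs)
        ≈⟨ altsum-cong (λ k → trans (⊝-cong (*-leftComm (w c) (u k) _) refl) (sym (*-⊝ _ _ _))) ⟩
      altsum (λ k → u k * contract w (F k) (c ∷ cs)) ∎

    -- Both fields are recorded because `swap` only gives `F ≈ - F` at a repeated argument, which
    -- does not force `0#` when 2 is a zero divisor.
    record Alternating (F : List J → Carrier) : Set ℓ where
      field
        swap   : ∀ pre c d post → F (pre ++ c ∷ d ∷ post) ≈ - F (pre ++ d ∷ c ∷ post)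
        repeat : ∀ pre c post → F (pre ++ c ∷ c ∷ post) ≈ 0#
    open Alternating public

    Alternating-∷ : ∀ {F} c → Alternating F → Alternating (λ ds → F (c ∷ ds))
    Alternating-∷ c altF .swap pre   = altF .swap (c ∷ pre)
    Alternating-∷ c altF .repeat pre = altF .repeat (c ∷ pre)

    -- In the expansion at two adjacent arguments, the two terms that remove one of them trade
    -- places with opposite signs; in all others both arguments stay inside `F`, which alternates.
    Alternating-contract : ∀ w {F} → Alternating F → Alternating (contract w F)
    Alternating-contract w {F} altF .swap [] c d post = begin
      p ⊝ (q ⊝ contract w (λ ds → F (c ∷ d ∷ ds)) post)  ≈⟨ ⊝-cong refl (⊝-cong refl Y≈-Z) ⟩
      p ⊝ (q ⊝ - Z)                                      ≈⟨ ⊝-cong (⊝-identityʳ p) refl ⟨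
      (p ⊝ 0#) ⊝ (q ⊝ - Z)                               ≈⟨ ⊝-⊝-interchange p 0# q (- Z) ⟩
      (p ⊝ q) ⊝ (0# ⊝ - Z)                               ≈⟨ ⊝-cong refl (trans (+-identityˡ _) (-‿involutive Z)) ⟩
      (p ⊝ q) ⊝ Z                                        ≈⟨ +-assoc _ _ _ ⟩
      p + (- q ⊝ Z)                                      ≈⟨ +-congˡ (+-comm _ _) ⟩
      p + (- Z ⊝ q)                                      ≈⟨ +-assoc _ _ _ ⟨
      (p ⊝ Z) ⊝ q                                        ≈⟨ neg-⊝ _ _ ⟨
      - (q ⊝ (p ⊝ Z))                                    ∎
      where
      p = w c * F (d ∷ post)
      q = w d * F (c ∷ post)
      Z = contract w (λ ds → F (d ∷ c ∷ ds)) post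
      Y≈-Z : contract w (λ ds → F (c ∷ d ∷ ds)) post ≈ - Z
      Y≈-Z = trans (contract-congʳ (altF .swap [] c d) post) (contract-neg _ post)
    Alternating-contract w {F} altF .swap (a ∷ pre) c d post = begin
      w a * F (pre ++ c ∷ d ∷ post) ⊝ contract w (λ ds → F (a ∷ ds)) (pre ++ c ∷ d ∷ post)
        ≈⟨ ⊝-cong (trans (*-congˡ (altF .swap pre c d post)) (sym (-‿distribʳ-* _ _)))
                  (Alternating-contract w (Alternating-∷ a altF) .swap pre c d post) ⟩
      - (w a * F (pre ++ d ∷ c ∷ post)) ⊝ - contract w (λ ds → F (a ∷ ds)) (pre ++ d ∷ c ∷ post)
        ≈⟨ -‿+-comm _ _ ⟩
      - contract w F (a ∷ pre ++ d ∷ c ∷ post) ∎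
    Alternating-contract w {F} altF .repeat [] c post = begin
      p ⊝ (p ⊝ contract w (λ ds → F (c ∷ c ∷ ds)) post)
        ≈⟨ ⊝-cong refl (trans (⊝-cong refl (contract-0ʳ (altF .repeat [] c) post)) (⊝-identityʳ p)) ⟩
      p ⊝ p ≈⟨ -‿inverseʳ p ⟩
      0# ∎
      where p = w c * F (c ∷ post)
    Alternating-contract w {F} altF .repeat (a ∷ pre) c post =
      trans (⊝-cong (trans (*-congˡ (altF .repeat pre c post)) (zeroʳ _))
                    (Alternating-contract w (Alternating-∷ a altF) .repeat pre c post))
            (⊝-identityʳ 0#)

  contract-map : {J J′ : Set} (f : J → J′) {w : J′ → Carrier} (F : List J′ → Carrier) →
    ∀ cs → contract w F (map f cs) ≡ contract (w ∘ f) (F ∘ map f) cs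
  contract-map f F []               = ≡.refl
  contract-map f {w} F (c ∷ cs) =
    ≡.cong (λ z → w (f c) * F (map f cs) ⊝ z) (contract-map f (λ ds → F (f c ∷ ds)) cs)

  Alternating-map : {J J′ : Set} (f : J → J′) {F : List J′ → Carrier} →
    Alternating F → Alternating (F ∘ map f)
  Alternating-map f {F} altF .swap pre c d post
    rewrite map-++ f pre (c ∷ d ∷ post) | map-++ f pre (d ∷ c ∷ post) =
    altF .swap (map f pre) (f c) (f d) (map f post)
  Alternating-map f {F} altF .repeat pre c post
    rewrite map-++ f pre (c ∷ c ∷ post) = altF .repeat (map f pre) (f c) (map f post)

  module _ {I J : Set} where

    Alternating-D : ∀ (M : I → J → Carrier) rs → Alternating (D M rs)
    Alternating-D M [] .swap []        c d post = sym -0#≈0#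
    Alternating-D M [] .swap (_ ∷ _)   c d post = sym -0#≈0#
    Alternating-D M [] .repeat []      c post   = refl
    Alternating-D M [] .repeat (_ ∷ _) c post   = refl
    Alternating-D M (r ∷ rs) = Alternating-contract (M r) (Alternating-D M rs)

    -- The predicates are there because (i)-(iii) give equality of entries only on the complements
    -- of `A` and `B`.
    D-cong : {P : I → Set} {Q : J → Set} {M M′ : I → J → Carrier} →
      (∀ {r c} → P r → Q c → M r c ≈ M′ r c) →
      ∀ {rs cs} → All P rs → All Q cs → D M rs cs ≈ D M′ rs cs
    D-cong p []         []        = refl
    D-cong p []         (_ ∷ _)   = refl
    D-cong p (pr ∷ prs) qcs       = contract-cong (p pr) (D-cong p prs) qcs

    -- Linearity in the first column, for an expansion along rows: either row `r` uses that column
    -- and its own hypothesis applies, or a later row does and induction applies.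
    D-linear : ∀ {m} (M : I → J → Carrier) (u : Fin m → Carrier) (κ : Fin m → J) {j rs} →
      All (λ r → M r j ≈ altsum (λ k → u k * M r (κ k))) rs →
      ∀ cs → D M rs (j ∷ cs) ≈ altsum (λ k → u k * D M rs (κ k ∷ cs))
    D-linear M u κ [] cs = sym (altsum-0 (λ k → zeroʳ (u k)))
    D-linear M u κ {j} {r ∷ rs} (pr ∷ prs) cs = begin
      M r j * D M rs cs ⊝ contract (M r) (λ ds → D M rs (j ∷ ds)) cs
        ≈⟨ ⊝-cong (trans (*-comm _ _) (*-congˡ pr))
                  (trans (contract-congʳ (D-linear M u κ prs) cs) (contract-altsum u _ cs)) ⟩
      D M rs cs * altsum (λ k → u k * M r (κ k)) ⊝
      altsum (λ k → u k * contract (M r) (λ ds → D M rs (κ k ∷ ds)) cs)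
        ≈⟨ ⊝-cong (altsum-*ˡ _ (λ k → u k * M r (κ k))) refl ⟩
      altsum (λ k → D M rs cs * (u k * M r (κ k))) ⊝
      altsum (λ k → u k * contract (M r) (λ ds → D M rs (κ k ∷ ds)) cs)
        ≈⟨ altsum-⊝ (λ k → D M rs cs * (u k * M r (κ k))) _ ⟩
      altsum (λ k → D M rs cs * (u k * M r (κ k)) ⊝ u k * contract (M r) (λ ds → D M rs (κ k ∷ ds)) cs)
        ≈⟨ altsum-cong (λ k → trans (⊝-cong (trans (*-leftComm _ (u k) (M r (κ k))) (*-congˡ (*-comm _ (M r (κ k))))) refl)
                                    (sym (*-⊝ _ _ _))) ⟩
      altsum (λ k → u k * D M (r ∷ rs) (κ k ∷ cs)) ∎

    D-zeroColumn : ∀ (M : I → J → Carrier) {j rs} → All (λ r → M r j ≈ 0#) rs →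
      ∀ cs → D M rs (j ∷ cs) ≈ 0#
    -- A zero column is the combination of no columns.
    D-zeroColumn M {j} p cs = D-linear {0} M (λ ()) (λ ()) p cs

    -- The local functions of det are out of scope; unification recovers them.
    module _ (M : I → J → Carrier) (r : I) (rs : List I) where
      mutual
        expand : Carrier → List J → List J → Carrier
        expand = λ s pre post → _

        det-∷ : ∀ cs → det R M (r ∷ rs) cs ≡ expand 1# [] cs
        -- Generalising `1#` and the empty prefix to variables makes the equation for the hidden
        -- function a solvable pattern problem.
        det-∷ cs with 1# | id {A = List J} []
        ... | s | pre = expand-≡ s pre cs
          where
          expand-≡ : ∀ s pre cs → _ ≡ expand s pre cs
          expand-≡ s pre cs = ≡.refl

      mutual
        revApp : Carrier → J → List J → List J → List J
        revApp = λ s c zs ys → _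

        expand-∷ : ∀ s pre c post → expand s pre (c ∷ post) ≡
          s * M r c * det R M rs (revApp s c pre post) + expand (- s) (c ∷ pre) post
        expand-∷ s pre c post = ≡.refl

      revApp≡ʳ++ : ∀ s c zs ys → revApp s c zs ys ≡ zs ʳ++ ys
      revApp≡ʳ++ s c []       ys = ≡.refl
      revApp≡ʳ++ s c (z ∷ zs) ys = revApp≡ʳ++ s c zs (z ∷ ys)

      -- The sign accumulator factors out, and putting the passed columns back in front of the
      -- argument turns the loop into a contraction.
      expand≈contract : ∀ s pre post →
        expand s pre post ≈ s * contract (M r) (λ ds → det R M rs (pre ʳ++ ds)) post
      expand≈contract s pre []         = sym (zeroʳ s)
      expand≈contract s pre (c ∷ post) = begin
        s * M r c * det R M rs (revApp s c pre post) + expand (- s) (c ∷ pre) post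
          ≈⟨ +-cong (trans (*-congˡ (reflexive (≡.cong (det R M rs) (revApp≡ʳ++ s c pre post)))) (*-assoc _ _ _))
                    (trans (expand≈contract (- s) (c ∷ pre) post) (sym (-‿distribˡ-* _ _))) ⟩
        s * (M r c * det R M rs (pre ʳ++ post)) ⊝
        s * contract (M r) (λ ds → det R M rs (pre ʳ++ c ∷ ds)) post
          ≈⟨ *-⊝ _ _ _ ⟨
        s * contract (M r) (λ ds → det R M rs (pre ʳ++ ds)) (c ∷ post) ∎

    det≈D : ∀ (M : I → J → Carrier) rs cs → det R M rs cs ≈ D M rs cs
    det≈D M []       []      = refl
    det≈D M []       (_ ∷ _) = refl
    det≈D M (r ∷ rs) cs      = begin
      det R M (r ∷ rs) cs                  ≈⟨ reflexive (det-∷ M r rs cs) ⟩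
      expand M r rs 1# [] cs               ≈⟨ expand≈contract M r rs 1# [] cs ⟩
      1# * contract (M r) (det R M rs) cs  ≈⟨ *-identityˡ _ ⟩
      contract (M r) (det R M rs) cs       ≈⟨ contract-congʳ (det≈D M rs) cs ⟩
      D M (r ∷ rs) cs                      ∎

  D-map : {I I′ J J′ : Set} (f : I → I′) (g : J → J′) (M : I′ → J′ → Carrier) →
    ∀ rs cs → D M (map f rs) (map g cs) ≈ D (λ r c → M (f r) (g c)) rs cs
  D-map f g M []       []      = refl
  D-map f g M []       (_ ∷ _) = refl
  D-map f g M (r ∷ rs) cs      =
    trans (reflexive (contract-map g (D M (map f rs)) cs)) (contract-congʳ (D-map f g M rs) cs)

  -- Complementary minors of unitriangular matrices.

  -- The sign of the position of c in B times the sign of its position in ∁ B ∪ {c} is (-1)^c.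
  contract-∁ : ∀ {m K} (w : Fin m → Carrier) {F F′ : List (Fin m) → Carrier} → Alternating F′ →
    (∀ B → suc ∣ B ∣ ≡ K → F (elems B) ≈ F′ (elems (∁ B))) →
    ∀ B → ∣ B ∣ ≡ K →
    contract w F (elems B) ≈ altsum (λ k → w k * F′ (k ∷ elems (∁ B)))
  contract-∁ w altF′ F≈F′ [] ≡.refl = refl
  contract-∁ w {F} {F′} altF′ F≈F′ (true ∷ B) ≡.refl = ⊝-cong
    (*-congˡ (F≈F′ (false ∷ B) ≡.refl))
    (trans (reflexive (contract-map suc (λ ds → F (zero ∷ ds)) (elems B)))
      (contract-∁ (w ∘ suc) (Alternating-map suc altF′) (λ B′ p → F≈F′ (true ∷ B′) (≡.cong suc p)) B ≡.refl))
  contract-∁ {suc m} w {F} {F′} altF′ F≈F′ (false ∷ B) ≡.refl = begin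
    contract w F (map suc (elems B))
      ≡⟨ contract-map suc F (elems B) ⟩
    contract (w ∘ suc) (F ∘ map suc) (elems B)
      ≈⟨ contract-∁ (w ∘ suc) (Alternating-map suc (Alternating-∷ zero altF′)) (λ B′ → F≈F′ (false ∷ B′)) B ≡.refl ⟩
    altsum (λ k → w (suc k) * F′ (zero ∷ suc k ∷ cs))
      -- Here 0 lies in `∁ B`; moving `suc k` in front of it costs a sign, which accounts for the
      -- shift of the summation index by one.
      ≈⟨ altsum-cong (λ k → trans (*-congˡ (altF′ .swap [] zero (suc k) cs)) (sym (-‿distribʳ-* _ _))) ⟩
    altsum (λ k → - (w (suc k) * F′ (suc k ∷ zero ∷ cs)))
      ≈⟨ altsum-neg (λ k → w (suc k) * F′ (suc k ∷ zero ∷ cs)) ⟩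
    - altsum (λ k → w (suc k) * F′ (suc k ∷ zero ∷ cs))
      ≈⟨ +-identityˡ _ ⟨
    0# ⊝ altsum (λ k → w (suc k) * F′ (suc k ∷ zero ∷ cs))
      -- The term for index 0 can be supplied because it repeats a column and so vanishes.
      ≈⟨ ⊝-cong (trans (*-congˡ (altF′ .repeat [] zero cs)) (zeroʳ _)) refl ⟨
    w zero * F′ (zero ∷ zero ∷ cs) ⊝ altsum (λ k → w (suc k) * F′ (suc k ∷ zero ∷ cs)) ∎
    where cs = map suc (elems (∁ B))

  record UpperUnitriangular {m} (M : Fin m → Fin m → Carrier) : Set ℓ where
    field
      diagonal : ∀ i → M i i ≈ 1#
      below    : ∀ {i j} → j Fin.< i → M i j ≈ 0#
  open UpperUnitriangular

  minor₀₀ : ∀ {m} → (Fin (suc m) → Fin (suc m) → Carrier) → Fin m → Fin m → Carrier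
  minor₀₀ M i j = M (suc i) (suc j)

  minor₀₀-upper : ∀ {m} {M : Fin (suc m) → Fin (suc m) → Carrier} →
    UpperUnitriangular M → UpperUnitriangular (minor₀₀ M)
  minor₀₀-upper upM .diagonal i = upM .diagonal (suc i)
  minor₀₀-upper upM .below j<i  = upM .below (s≤s j<i)

  -- Jacobi's complementary minor theorem: the last hypothesis says that
  -- the inverse of M is ((-1)^(i+j) N i j).
  complementaryMinor : ∀ {m} {M N : Fin m → Fin m → Carrier} →
    UpperUnitriangular M → UpperUnitriangular N →
    (∀ {i j} → i Fin.< j → altsum (λ k → M i k * N k j) ≈ 0#) →
    ∀ A B → ∣ A ∣ ≡ ∣ B ∣ →
    D M (elems A) (elems B) ≈ D (flip N) (elems (∁ A)) (elems (∁ B))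
  complementaryMinor upM upN inv [] [] eq = refl
  complementaryMinor {suc m} {M} {N} upM upN inv (x ∷ A) (y ∷ B) eq = go x y eq
    where
    as bs as′ bs′ : List (Fin (suc m))
    as  = map suc (elems A)
    bs  = map suc (elems B)
    as′ = map suc (elems (∁ A))
    bs′ = map suc (elems (∁ B))

    all-map-suc : {P : Fin (suc m) → Set ℓ} → (∀ i → P (suc i)) → ∀ is → All P (map suc is)
    all-map-suc p is = map⁺ (All.universal p is)

    M-column₀ : ∀ i → M (suc i) zero ≈ 0#
    M-column₀ i = upM .below (s≤s z≤n)

    N-column₀ : ∀ i → N (suc i) zero ≈ 0#
    N-column₀ i = upN .below (s≤s z≤n)

    -- Column 0 of `M` vanishes below the diagonal, so dropping index 0 from the sum only changes
    -- its sign.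
    inv′ : ∀ {i j} → i Fin.< j → altsum (λ k → minor₀₀ M i k * minor₀₀ N k j) ≈ 0#
    inv′ {i} {j} i<j = begin
      S                                 ≈⟨ -‿involutive S ⟨
      - - S                             ≈⟨ -‿cong (+-identityˡ (- S)) ⟨
      - (0# ⊝ S)                        ≈⟨ -‿cong (⊝-cong (trans (*-congʳ (M-column₀ i)) (zeroˡ _)) refl) ⟨
      - (M (suc i) zero * N zero (suc j) ⊝ S)  ≈⟨ -‿cong (inv (s≤s i<j)) ⟩
      - 0#                              ≈⟨ -0#≈0# ⟩
      0#                                ∎
      where S = altsum (λ k → minor₀₀ M i k * minor₀₀ N k j)

    -- The inverse relation in row 0, solved for the term with `M zero zero ≈ 1#`: off the diagonal,
    -- row 0 of `N` is a combination of the lower rows.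
    N-row₀ : ∀ j → N zero (suc j) ≈ altsum (λ k → M zero (suc k) * N (suc k) (suc j))
    N-row₀ j = begin
      N zero (suc j)      ≈⟨ *-identityˡ _ ⟨
      1# * N zero (suc j) ≈⟨ *-congʳ (upM .diagonal zero) ⟨
      M zero zero * N zero (suc j) ≈⟨ x∙y⁻¹≈ε⇒x≈y _ _ (inv (s≤s z≤n)) ⟩
      altsum (λ k → M zero (suc k) * N (suc k) (suc j)) ∎

    rec : ∀ B → ∣ A ∣ ≡ ∣ B ∣ → D M as (map suc (elems B)) ≈ D (flip N) as′ (map suc (elems (∁ B)))
    rec B p = begin
      D M as (map suc (elems B))                            ≈⟨ D-map suc suc M (elems A) (elems B) ⟩
      D (minor₀₀ M) (elems A) (elems B)
        ≈⟨ complementaryMinor (minor₀₀-upper upM) (minor₀₀-upper upN) inv′ A B p ⟩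
      D (flip (minor₀₀ N)) (elems (∁ A)) (elems (∁ B))      ≈⟨ D-map suc suc (flip N) (elems (∁ A)) (elems (∁ B)) ⟨
      D (flip N) as′ (map suc (elems (∁ B)))                ∎

    go : ∀ x y → ∣ x ∷ A ∣ ≡ ∣ y ∷ B ∣ →
      D M (elems (x ∷ A)) (elems (y ∷ B)) ≈ D (flip N) (elems (∁ (x ∷ A))) (elems (∁ (y ∷ B)))
    go true true p = begin
      M zero zero * D M as bs ⊝ contract (M zero) (λ ds → D M as (zero ∷ ds)) bs
        ≈⟨ ⊝-cong (trans (*-congʳ (upM .diagonal zero)) (*-identityˡ _))
                  (contract-0ʳ (D-zeroColumn M (all-map-suc M-column₀ (elems A))) bs) ⟩
      D M as bs ⊝ 0#       ≈⟨ ⊝-identityʳ _ ⟩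
      D M as bs            ≈⟨ rec B (ℕ.suc-injective p) ⟩
      D (flip N) as′ bs′   ∎
    -- Expanding row 0 of `M` removes one column from `B`, hence adds it to the complement. By
    -- `N-row₀` the resulting minors combine into the single minor that has 0 as its first column.
    go true false p = begin
      contract (M zero) (D M as) bs
        ≡⟨ contract-map suc (D M as) (elems B) ⟩
      contract (M zero ∘ suc) (D M as ∘ map suc) (elems B)
        ≈⟨ contract-∁ (M zero ∘ suc) (Alternating-map suc (Alternating-D (flip N) as′))
             (λ B′ q → rec B′ (ℕ.suc-injective (≡.trans p (≡.sym q)))) B ≡.refl ⟩
      altsum (λ k → M zero (suc k) * D (flip N) as′ (suc k ∷ bs′))
        ≈⟨ D-linear (flip N) (M zero ∘ suc) suc (all-map-suc N-row₀ (elems (∁ A))) bs′ ⟨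
      D (flip N) as′ (zero ∷ bs′) ∎
    -- Both sides vanish: the left one contains column 0 of `M` below the diagonal, the right one
    -- column 0 of `N` below the diagonal, as a row of the transpose.
    go false true p = begin
      D M as (zero ∷ bs)
        ≈⟨ D-zeroColumn M (all-map-suc M-column₀ (elems A)) bs ⟩
      0#
        ≈⟨ contract-0ˡ N-column₀ (elems (∁ B)) ⟨
      contract (λ k → N (suc k) zero) (D (flip N) as′ ∘ map suc) (elems (∁ B))
        ≡⟨ contract-map suc (D (flip N) as′) (elems (∁ B)) ⟨
      contract (λ k → N k zero) (D (flip N) as′) bs′ ∎
    go false false p = begin
      D M as bs            ≈⟨ rec B p ⟩
      D (flip N) as′ bs′   ≈⟨ ⊝-identityʳ _ ⟨
      D (flip N) as′ bs′ ⊝ 0#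
        ≈⟨ ⊝-cong (trans (*-congʳ (upN .diagonal zero)) (*-identityˡ _)) contract≈0 ⟨
      N zero zero * D (flip N) as′ bs′ ⊝
      contract (λ k → N k zero) (λ ds → D (flip N) as′ (zero ∷ ds)) bs′ ∎
      where
      contract≈0 : contract (λ k → N k zero) (λ ds → D (flip N) as′ (zero ∷ ds)) bs′ ≈ 0#
      contract≈0 = trans (reflexive (contract-map suc (λ ds → D (flip N) as′ (zero ∷ ds)) (elems (∁ B))))
                         (contract-0ˡ N-column₀ (elems (∁ B)))

  -- Recursions for `eₙ` and `hₙ` over ranges of variables.

  -- The index `t` will stand for the variable `x (suc t)`, so the half-open range `p ≤ t < q` is
  -- that of `vars R x p q`.
  sumFrom : (ℕ → Carrier) → ℕ → ℕ → Carrier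
  sumFrom f p zero = 0#
  sumFrom f p (suc q) with p ℕ.≤? q
  ... | yes _ = sumFrom f p q + f q
  ... | no  _ = 0#

  sumFrom-suc : ∀ f {p q} → p ℕ.≤ q → sumFrom f p (suc q) ≡ sumFrom f p q + f q
  sumFrom-suc f {p} {q} p≤q with p ℕ.≤? q
  ... | yes _   = ≡.refl
  ... | no  p≰q = contradiction p≤q p≰q

  sumFrom-empty : ∀ f {p q} → q ℕ.≤ p → sumFrom f p q ≡ 0#
  sumFrom-empty f {p} {zero}  q≤p = ≡.refl
  sumFrom-empty f {p} {suc q} q<p with p ℕ.≤? q
  ... | yes p≤q = contradiction p≤q (ℕ.<⇒≱ q<p)
  ... | no  _   = ≡.refl

  sumFrom-cong : ∀ {f g p} q → (∀ {t} → t ℕ.< q → f t ≈ g t) → sumFrom f p q ≈ sumFrom g p q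
  sumFrom-cong zero f≈g = refl
  sumFrom-cong {p = p} (suc q) f≈g with p ℕ.≤? q
  ... | yes _ = +-cong (sumFrom-cong q (f≈g ∘ ℕ.m<n⇒m<1+n)) (f≈g ℕ.≤-refl)
  ... | no  _ = refl

  sumFrom-0 : ∀ {f p} q → (∀ {t} → t ℕ.< q → f t ≈ 0#) → sumFrom f p q ≈ 0#
  sumFrom-0 zero f≈0 = refl
  sumFrom-0 {p = p} (suc q) f≈0 with p ℕ.≤? q
  ... | yes _ = trans (+-cong (sumFrom-0 q (f≈0 ∘ ℕ.m<n⇒m<1+n)) (f≈0 ℕ.≤-refl)) (+-identityʳ 0#)
  ... | no  _ = refl

  eₙ-vanish : ∀ {k} ys → length ys ℕ.< k → eₙ R k ys ≈ 0#
  eₙ-vanish {suc k} []       _         = refl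
  eₙ-vanish {suc k} (y ∷ ys) (s≤s lt) =
    trans (+-cong (eₙ-vanish ys (ℕ.m<n⇒m<1+n lt)) (trans (*-congˡ (eₙ-vanish ys lt)) (zeroʳ y)))
          (+-identityʳ 0#)

  module _ (x : ℕ → Carrier) where

    vars-suc : ∀ {p q} → p ℕ.≤ q → vars R x p (suc q) ≡ x (suc q) ∷ vars R x p q
    vars-suc {p} {q} p≤q
      rewrite ℕ.+-∸-assoc 1 p≤q | ℕ.+-suc p (q ∸ p) | ℕ.m+[n∸m]≡n p≤q = ≡.refl

    vars-empty : ∀ {p q} → q ℕ.≤ p → vars R x p q ≡ []
    vars-empty q≤p rewrite ℕ.m≤n⇒m∸n≡0 q≤p = ≡.refl

    length-vars : ∀ p q → length (vars R x p q) ≡ q ∸ p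
    length-vars p zero = ≡.trans (≡.cong length (vars-empty {p} z≤n)) (≡.sym (ℕ.0∸n≡0 p))
    length-vars p (suc q) with p ℕ.≤? q
    ... | yes p≤q = ≡.trans (≡.cong length (vars-suc p≤q))
                      (≡.trans (≡.cong suc (length-vars p q)) (≡.sym (ℕ.+-∸-assoc 1 p≤q)))
    ... | no  p≰q = ≡.trans (≡.cong length (vars-empty (ℕ.≰⇒> p≰q)))
                      (≡.sym (ℕ.m≤n⇒m∸n≡0 (ℕ.≰⇒> p≰q)))

    eₙ-vars-vanish : ∀ {k p q} → q ℕ.< p ℕ.+ suc k → eₙ R (suc k) (vars R x p q) ≈ 0#
    eₙ-vars-vanish {k} {p} {q} q<p+k = eₙ-vanish (vars R x p q)
      (≡.subst (ℕ._< suc k) (≡.sym (length-vars p q)) (ℕ.m<n+o⇒m∸n<o q p q<p+k))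

    hₙ-vars-suc : ∀ {p q} k → p ℕ.≤ q → hₙ R (suc k) (vars R x p (suc q)) ≈
      hₙ R (suc k) (vars R x p q) + x (suc q) * hₙ R k (vars R x p (suc q))
    hₙ-vars-suc k p≤q rewrite vars-suc p≤q = refl

    hₙ-vars-empty : ∀ {p q} k → q ℕ.≤ p → hₙ R (suc k) (vars R x p q) ≡ 0#
    hₙ-vars-empty k q≤p rewrite vars-empty q≤p = ≡.refl

    -- Monomials are sorted by their largest variable `x (suc t)`, which may occur again in the
    -- remaining factor.
    hₙ-vars : ∀ k p q → hₙ R (suc k) (vars R x p q) ≈
      sumFrom (λ t → x (suc t) * hₙ R k (vars R x p (suc t))) p q
    hₙ-vars k p zero = reflexive (hₙ-vars-empty {p} k z≤n)
    hₙ-vars k p (suc q) with p ℕ.≤? q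
    ... | yes p≤q = trans (hₙ-vars-suc k p≤q) (+-congʳ (hₙ-vars k p q))
    ... | no  p≰q = reflexive (hₙ-vars-empty k (ℕ.≰⇒> p≰q))

    -- The values t < p′ may be omitted from the sum because their terms vanish.
    eₙ-vars : ∀ {k p p′} q → p ℕ.≤ p′ → p′ ℕ.≤ p ℕ.+ k → eₙ R (suc k) (vars R x p q) ≈
      sumFrom (λ t → x (suc t) * eₙ R k (vars R x p t)) p′ q
    eₙ-vars {k} {p} zero p≤p′ p′≤p+k rewrite vars-empty {p} {0} z≤n = refl
    eₙ-vars {k} {p} {p′} (suc q) p≤p′ p′≤p+k with p′ ℕ.≤? q
    ... | yes p′≤q = trans (reflexive (≡.cong (eₙ R (suc k)) (vars-suc (ℕ.≤-trans p≤p′ p′≤q))))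
                           (+-congʳ (eₙ-vars q p≤p′ p′≤p+k))
    ... | no  p′≰q = eₙ-vars-vanish (ℕ.≤-<-trans (ℕ.≰⇒> p′≰q)
                       (≡.subst (p′ ℕ.<_) (≡.sym (ℕ.+-suc p k)) (s≤s p′≤p+k)))

    -- The two unitriangular matrices of the factorisation.

    module _ (α β : ℕ → ℕ) where

      -- strict k c m is the sum of x(t₁) ⋯ x(tₖ) over m ≥ t₁ > ⋯ > tₖ with
      -- α(c + i) < tᵢ ≤ β(c + i).
      strict : ℕ → ℕ → ℕ → Carrier
      strict zero    c m = 1#
      strict (suc k) c m = sumFrom (λ t → x (suc t) * strict k (suc c) t) (α (suc c)) (m ⊓ β (suc c))

      strictℤ : ℤ → ℕ → ℕ → Carrier
      strictℤ (+ k)    = strict k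
      strictℤ -[1+ _ ] = λ _ _ → 0#

      hEntry : ℕ → ℕ → Carrier
      hEntry a b = h R (+ b - + a) (vars R x (α (suc a)) (β b))

      -- The sum `G(c,b)`: the bound `β (suc c)` gives the largest factor its full range.
      strictEntry : ℕ → ℕ → Carrier
      strictEntry c b = strictℤ (+ b - + c) c (β (suc c))

      h-+ : ∀ {z i} ys → z ≡ + i → h R z ys ≡ hₙ R i ys
      h-+ ys ≡.refl = ≡.refl

      h-<0 : ∀ {z} ys → z < + 0 → h R z ys ≡ 0#
      h-<0 { -[1+ _ ]} ys _ = ≡.refl
      h-<0 {+ _}       ys (+<+ ())

      strictℤ-+ : ∀ {z j c m} → z ≡ + j → strictℤ z c m ≡ strict j c m
      strictℤ-+ ≡.refl = ≡.refl

      strictℤ-<0 : ∀ {z c m} → z < + 0 → strictℤ z c m ≡ 0#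
      strictℤ-<0 { -[1+ _ ]} _ = ≡.refl
      strictℤ-<0 {+ _}       (+<+ ())

      h-diagonal : ∀ i → hEntry i i ≈ 1#
      h-diagonal i = reflexive (h-+ {i = 0} _ (ℤ.+-inverseʳ (+ i)))

      strict-diagonal : ∀ i → strictEntry i i ≈ 1#
      strict-diagonal i = reflexive (strictℤ-+ {j = 0} (ℤ.+-inverseʳ (+ i)))

      h-below : ∀ {i j} → j ℕ.< i → hEntry i j ≈ 0#
      h-below j<i = reflexive (h-<0 _ (m<n⇒m-n<0 j<i))

      strict-below : ∀ {i j} → j ℕ.< i → strictEntry i j ≈ 0#
      strict-below j<i = reflexive (strictℤ-<0 (m<n⇒m-n<0 j<i))

      -- The increment of `strict` in its upper bound, for the summation by parts; from `β (suc c)`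
      -- on, `strict-clip` makes it constant.
      strict-step : ∀ j c {q} → α (suc c) ℕ.≤ q → suc q ℕ.≤ β (suc c) →
        strict (suc j) c (suc q) ≈ strict (suc j) c q + x (suc q) * strict j (suc c) q
      strict-step j c {q} α≤q q<β
        rewrite ℕ.m≤n⇒m⊓n≡m q<β | ℕ.m≤n⇒m⊓n≡m (ℕ.<⇒≤ q<β) = reflexive (sumFrom-suc _ α≤q)

      strict-clip : ∀ j c {m} → β (suc c) ℕ.≤ m → strict (suc j) c m ≡ strict (suc j) c (β (suc c))
      strict-clip j c {m} β≤m
        rewrite ℕ.m≥n⇒m⊓n≡n β≤m | ℕ.⊓-idem (β (suc c)) = ≡.refl

      -- Summation by parts and the telescoping product.

      -- Summation by parts in q.
      hₙ*strict : ∀ k j c {p} → α (suc c) ℕ.≤ p → ∀ q →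
        hₙ R (suc k) (vars R x p q) * strict (suc j) c q ≈
        sumFrom (λ t → x (suc t) * hₙ R k (vars R x p (suc t)) * strict (suc j) c t) p q +
        sumFrom (λ t → x (suc t) * hₙ R (suc k) (vars R x p (suc t)) * strict j (suc c) t) p (q ⊓ β (suc c))
      hₙ*strict k j c {p} α≤p zero = begin
        hₙ R (suc k) (vars R x p 0) * strict (suc j) c 0  ≈⟨ *-congʳ (reflexive (hₙ-vars-empty {p} k z≤n)) ⟩
        0# * strict (suc j) c 0                           ≈⟨ zeroˡ _ ⟩
        0#                                                ≈⟨ +-identityʳ 0# ⟨
        0# + 0#                                           ∎
      hₙ*strict k j c {p} α≤p (suc q) with p ℕ.≤? q
      ... | no p≰q = begin
        hₙ R (suc k) (vars R x p (suc q)) * strict (suc j) c (suc q)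
          ≈⟨ *-congʳ (reflexive (hₙ-vars-empty k (ℕ.≰⇒> p≰q))) ⟩
        0# * strict (suc j) c (suc q)  ≈⟨ zeroˡ _ ⟩
        0#                             ≈⟨ +-identityʳ 0# ⟨
        0# + 0#
          ≈⟨ +-congˡ (reflexive (sumFrom-empty _ {p} (ℕ.≤-trans (ℕ.m⊓n≤m (suc q) (β (suc c))) (ℕ.≰⇒> p≰q)))) ⟨
        0# + sumFrom (λ t → x (suc t) * hₙ R (suc k) (vars R x p (suc t)) * strict j (suc c) t) p (suc q ⊓ β (suc c)) ∎
      ... | yes p≤q with suc q ℕ.≤? β (suc c)
      -- Discrete product rule: the increment of the product is `x (suc q) * η * G` from the first
      -- factor plus `x (suc q) * H′ * γ` from the second.
      ...   | yes q<β = begin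
        H′ * strict (suc j) c (suc q)
          ≈⟨ *-congˡ (strict-step j c (ℕ.≤-trans α≤p p≤q) q<β) ⟩
        H′ * (G + x (suc q) * γ)
          ≈⟨ distribˡ _ _ _ ⟩
        H′ * G + H′ * (x (suc q) * γ)
          ≈⟨ +-cong (trans (*-congʳ (hₙ-vars-suc k p≤q)) (distribʳ _ _ _))
                    (trans (*-leftComm _ _ _) (sym (*-assoc _ _ _))) ⟩
        (H * G + x (suc q) * η * G) + x (suc q) * H′ * γ
          ≈⟨ +-congʳ (+-congʳ (hₙ*strict k j c α≤p q)) ⟩
        ((S₁ + sumFrom f₂ p (q ⊓ β (suc c))) + x (suc q) * η * G) + x (suc q) * H′ * γ
          ≡⟨ ≡.cong (λ z → ((S₁ + sumFrom f₂ p z) + x (suc q) * η * G) + x (suc q) * H′ * γ)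
                    (ℕ.m≤n⇒m⊓n≡m (ℕ.<⇒≤ q<β)) ⟩
        ((S₁ + S₂) + x (suc q) * η * G) + x (suc q) * H′ * γ
          ≈⟨ +-congʳ (trans (+-assoc _ _ _) (trans (+-congˡ (+-comm _ _)) (sym (+-assoc _ _ _)))) ⟩
        ((S₁ + x (suc q) * η * G) + S₂) + x (suc q) * H′ * γ
          ≈⟨ +-assoc _ _ _ ⟩
        (S₁ + x (suc q) * η * G) + (S₂ + x (suc q) * H′ * γ)
          ≡⟨ ≡.cong (λ z → (S₁ + x (suc q) * η * G) + z) (≡.sym (sumFrom-suc f₂ p≤q)) ⟩
        (S₁ + x (suc q) * η * G) + sumFrom f₂ p (suc q)
          ≡⟨ ≡.cong (λ z → (S₁ + x (suc q) * η * G) + sumFrom f₂ p z) (≡.sym (ℕ.m≤n⇒m⊓n≡m q<β)) ⟩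
        (S₁ + x (suc q) * η * G) + sumFrom f₂ p (suc q ⊓ β (suc c)) ∎
        where
        H  = hₙ R (suc k) (vars R x p q)
        H′ = hₙ R (suc k) (vars R x p (suc q))
        η  = hₙ R k (vars R x p (suc q))
        G  = strict (suc j) c q
        γ  = strict j (suc c) q
        f₂ = λ t → x (suc t) * hₙ R (suc k) (vars R x p (suc t)) * strict j (suc c) t
        S₁ = sumFrom (λ t → x (suc t) * hₙ R k (vars R x p (suc t)) * strict (suc j) c t) p q
        S₂ = sumFrom f₂ p q
      -- Past `β (suc c)` the factor `strict` is constant and the second sum has stopped growing.
      ...   | no q≮β = begin
        H′ * strict (suc j) c (suc q)
          ≡⟨ ≡.cong (H′ *_) (≡.trans (strict-clip j c (ℕ.m≤n⇒m≤1+n β≤q)) (≡.sym (strict-clip j c β≤q))) ⟩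
        H′ * G
          ≈⟨ trans (*-congʳ (hₙ-vars-suc k p≤q)) (distribʳ _ _ _) ⟩
        H * G + x (suc q) * η * G
          ≈⟨ +-congʳ (hₙ*strict k j c α≤p q) ⟩
        (S₁ + sumFrom f₂ p (q ⊓ β (suc c))) + x (suc q) * η * G
          ≈⟨ trans (+-assoc _ _ _) (trans (+-congˡ (+-comm _ _)) (sym (+-assoc _ _ _))) ⟩
        (S₁ + x (suc q) * η * G) + sumFrom f₂ p (q ⊓ β (suc c))
          ≡⟨ ≡.cong (λ z → (S₁ + x (suc q) * η * G) + sumFrom f₂ p z)
               (≡.trans (ℕ.m≥n⇒m⊓n≡n β≤q) (≡.sym (ℕ.m≥n⇒m⊓n≡n (ℕ.m≤n⇒m≤1+n β≤q)))) ⟩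
        (S₁ + x (suc q) * η * G) + sumFrom f₂ p (suc q ⊓ β (suc c)) ∎
        where
        β≤q : β (suc c) ℕ.≤ q
        β≤q = ℕ.≮⇒≥ q≮β
        H  = hₙ R (suc k) (vars R x p q)
        H′ = hₙ R (suc k) (vars R x p (suc q))
        η  = hₙ R k (vars R x p (suc q))
        G  = strict (suc j) c q
        f₂ = λ t → x (suc t) * hₙ R (suc k) (vars R x p (suc t)) * strict j (suc c) t
        S₁ = sumFrom (λ t → x (suc t) * hₙ R k (vars R x p (suc t)) * strict (suc j) c t) p q

      -- Sum over the sequences that weakly increase up to position c and strictly
      -- decrease from it.
      peak : ℕ → ℕ → ℕ → Carrier
      -- This default is the value to which the alternating sum telescopes.
      peak a b zero    = 0#
      peak a b (suc c) = sumFrom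
        (λ t → x (suc t) * h R (+ c - + a) (vars R x (α (suc a)) (suc t)) * strictℤ (+ b - + suc c) (suc c) t)
        (α (suc a)) (β (suc c))

      peak-suc : ∀ a c i j → c ≡ a ℕ.+ i → ∀ {b} → b ≡ suc c ℕ.+ j → peak a b (suc c) ≈
        sumFrom (λ t → x (suc t) * hₙ R i (vars R x (α (suc a)) (suc t)) * strict j (suc c) t) (α (suc a)) (β (suc c))
      peak-suc a c i j ≡.refl ≡.refl = sumFrom-cong (β (suc c)) (λ {t} _ →
        *-cong (*-congˡ (reflexive (h-+ _ ([a+i]-a≡i a i)))) (reflexive (strictℤ-+ ([a+i]-a≡i (suc c) j))))

      peak-low : ∀ a b {c} → c ℕ.≤ a → peak a b c ≈ 0#
      peak-low a b {zero}  _   = refl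
      peak-low a b {suc c} c<a = sumFrom-0 (β (suc c)) (λ _ →
        trans (*-congʳ (trans (*-congˡ (reflexive (h-<0 _ (m<n⇒m-n<0 c<a)))) (zeroʳ _))) (zeroˡ _))

      peak-high : ∀ a {b c} → b ℕ.< c → peak a b c ≈ 0#
      peak-high a {b} {suc c} b<c = sumFrom-0 (β (suc c)) (λ _ →
        trans (*-congˡ (reflexive (strictℤ-<0 (m<n⇒m-n<0 b<c)))) (zeroʳ _))

      module _ (α-antitone : ∀ {i j} → i ℕ.≤ j → α j ℕ.≤ α i)
               (β-antitone : ∀ {i j} → i ℕ.≤ j → β j ℕ.≤ β i) where

        -- The larger of the two leading factors becomes the peak: at `c` if it comes from `hEntry`,
        -- at `suc c` if it comes from `strictEntry`, to which ties go. For `c` equal to `a` or `b`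
        -- one matrix entry is 1 and one peak is 0; outside that range everything vanishes.
        h*strict : ∀ {a b} → a ℕ.< b → ∀ c → hEntry a c * strictEntry c b ≈ peak a b c + peak a b (suc c)
        h*strict {a} {b} a<b c with ℕ.<-cmp c a
        ... | tri< c<a _ _ = begin
          hEntry a c * strictEntry c b    ≈⟨ trans (*-congʳ (h-below c<a)) (zeroˡ _) ⟩
          0#                              ≈⟨ +-identityʳ 0# ⟨
          0# + 0#                         ≈⟨ +-cong (peak-low a b (ℕ.<⇒≤ c<a)) (peak-low a b c<a) ⟨
          peak a b c + peak a b (suc c)   ∎
        ... | tri≈ _ ≡.refl _ with j , ≡.refl ← ℕ.m≤n⇒∃[o]m+o≡n a<b = begin
          hEntry a a * strictEntry a (suc a ℕ.+ j)
            ≈⟨ trans (*-congʳ (h-diagonal a)) (*-identityˡ _) ⟩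
          strictEntry a (suc a ℕ.+ j)
            ≡⟨ strictℤ-+ {j = suc j} ([1+a+i]-a≡1+i a j) ⟩
          sumFrom (λ t → x (suc t) * strict j (suc a) t) (α (suc a)) (β (suc a) ⊓ β (suc a))
            ≡⟨ ≡.cong (sumFrom _ _) (ℕ.⊓-idem (β (suc a))) ⟩
          sumFrom (λ t → x (suc t) * strict j (suc a) t) (α (suc a)) (β (suc a))
            ≈⟨ sumFrom-cong (β (suc a)) (λ _ → *-congʳ (sym (*-identityʳ _))) ⟩
          sumFrom (λ t → x (suc t) * 1# * strict j (suc a) t) (α (suc a)) (β (suc a))
            ≈⟨ peak-suc a a 0 j (≡.sym (ℕ.+-identityʳ a)) ≡.refl ⟨
          peak a b (suc a)
            ≈⟨ +-identityˡ _ ⟨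
          0# + peak a b (suc a)
            ≈⟨ +-congʳ (peak-low a b ℕ.≤-refl) ⟨
          peak a b a + peak a b (suc a) ∎
        ... | tri> _ _ a<c with i , ≡.refl ← ℕ.m≤n⇒∃[o]m+o≡n a<c with ℕ.<-cmp c b
        ...   | tri< c<b _ _ with j , ≡.refl ← ℕ.m≤n⇒∃[o]m+o≡n c<b = begin
          hEntry a c * strictEntry c b
            -- Clipping lets the bound of the second factor be raised from `β (suc c)` to `β c`, so
            -- that both factors share one upper bound.
            ≈⟨ *-cong (reflexive (h-+ {i = suc i} _ c-a))
                      (reflexive (≡.trans (strictℤ-+ {j = suc j} b-c) (≡.sym (strict-clip j c β≤β)))) ⟩
          hₙ R (suc i) (vars R x (α (suc a)) (β c)) * strict (suc j) c (β c)
            -- Since `α (suc c) ≤ α (suc a)`, a factor of the second kind that becomes the peak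
            -- meets its own lower bound.
            ≈⟨ hₙ*strict i j c (α-antitone (ℕ.m≤n⇒m≤1+n a<c)) (β c) ⟩
          S₁ + sumFrom f₂ (α (suc a)) (β c ⊓ β (suc c))
            ≡⟨ ≡.cong (λ z → S₁ + sumFrom f₂ (α (suc a)) z) (ℕ.m≥n⇒m⊓n≡n β≤β) ⟩
          S₁ + sumFrom f₂ (α (suc a)) (β (suc c))
            ≈⟨ +-cong (peak-suc a (a ℕ.+ i) i (suc j) ≡.refl (≡.sym (ℕ.+-suc c j)))
                      (peak-suc a c (suc i) j (≡.sym (ℕ.+-suc a i)) ≡.refl) ⟨
          peak a b c + peak a b (suc c) ∎
          where
          f₂ = λ t → x (suc t) * hₙ R (suc i) (vars R x (α (suc a)) (suc t)) * strict j (suc c) t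
          S₁ = sumFrom (λ t → x (suc t) * hₙ R i (vars R x (α (suc a)) (suc t)) * strict (suc j) c t) (α (suc a)) (β c)
          β≤β : β (suc c) ℕ.≤ β c
          β≤β = β-antitone (ℕ.n≤1+n c)
          c-a : + c - + a ≡ + suc i
          c-a = [1+a+i]-a≡1+i a i
          b-c : + b - + c ≡ + suc j
          b-c = [1+a+i]-a≡1+i c j
        ...   | tri≈ _ ≡.refl _ = begin
          hEntry a c * strictEntry c c
            ≈⟨ trans (*-congˡ (strict-diagonal c)) (*-identityʳ _) ⟩
          hEntry a c
            ≡⟨ h-+ {i = suc i} _ ([1+a+i]-a≡1+i a i) ⟩
          hₙ R (suc i) (vars R x (α (suc a)) (β c))
            ≈⟨ hₙ-vars i (α (suc a)) (β c) ⟩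
          sumFrom (λ t → x (suc t) * hₙ R i (vars R x (α (suc a)) (suc t))) (α (suc a)) (β c)
            ≈⟨ sumFrom-cong (β c) (λ _ → sym (*-identityʳ _)) ⟩
          sumFrom (λ t → x (suc t) * hₙ R i (vars R x (α (suc a)) (suc t)) * 1#) (α (suc a)) (β c)
            ≈⟨ peak-suc a (a ℕ.+ i) i 0 ≡.refl (≡.sym (ℕ.+-identityʳ c)) ⟨
          peak a c c
            ≈⟨ +-identityʳ _ ⟨
          peak a c c + 0#
            ≈⟨ +-congˡ (peak-high a {c} {suc c} ℕ.≤-refl) ⟨
          peak a c c + peak a c (suc c) ∎
        ...   | tri> _ _ b<c = begin
          hEntry a c * strictEntry c b    ≈⟨ trans (*-congˡ (strict-below b<c)) (zeroʳ _) ⟩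
          0#                              ≈⟨ +-identityʳ 0# ⟨
          0# + 0#                         ≈⟨ +-cong (peak-high a b<c) (peak-high a {b} {suc c} (ℕ.m<n⇒m<1+n b<c)) ⟨
          peak a b c + peak a b (suc c)   ∎

        h-strict-inverse : ∀ m {i j} → i ℕ.< j → j ℕ.< m →
          altsum {m} (λ k → hEntry i (toℕ k) * strictEntry (toℕ k) j) ≈ 0#
        h-strict-inverse m {i} {j} i<j j<m = trans
          (altsum-cong {m} (λ k → h*strict i<j (toℕ k)))
          (altsum-telescope (peak i j) m (peak-high i j<m))

        -- Comparison of the strict sums with elementary symmetric polynomials.

        -- The invariant `m + suc c ≤ β (suc b) + suc b` survives each factor, as `c` rises by one
        -- and the bound drops by at least one; with (iii) it implies every upper bound. A value `t`
        -- below `α (suc c)` leaves fewer than `j` variables above `α a` for `j` factors, so the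
        -- lower bounds cost nothing either.
        strict≈eₙ : ∀ {a b} →
          (∀ i → suc b ℕ.≤ i → i ℕ.≤ a → α i ℕ.+ i ℕ.≤ α a ℕ.+ a × β (suc b) ℕ.+ suc b ℕ.≤ β i ℕ.+ i) →
          ∀ j c {m} → c ℕ.+ j ≡ a → b ℕ.≤ c → m ℕ.+ suc c ℕ.≤ β (suc b) ℕ.+ suc b →
          strict j c m ≈ eₙ R j (vars R x (α a) m)
        strict≈eₙ hyp zero    c c+j≡a b≤c m≤ = refl
        strict≈eₙ {a} {b} hyp (suc j) c {m} ≡.refl b≤c m≤ = begin
          sumFrom (λ t → x (suc t) * strict j (suc c) t) (α (suc c)) (m ⊓ β (suc c))
            ≡⟨ ≡.cong (sumFrom _ _) (ℕ.m≤n⇒m⊓n≡m m≤β) ⟩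
          sumFrom (λ t → x (suc t) * strict j (suc c) t) (α (suc c)) m
            ≈⟨ sumFrom-cong m (λ {t} t<m → *-congˡ (strict≈eₙ hyp j (suc c) (≡.sym (ℕ.+-suc c j))
                 (ℕ.m≤n⇒m≤1+n b≤c)
                 (ℕ.≤-trans (ℕ.≤-reflexive (ℕ.+-suc t (suc c))) (ℕ.≤-trans (ℕ.+-monoˡ-≤ (suc c) t<m) m≤)))) ⟩
          sumFrom (λ t → x (suc t) * eₙ R j (vars R x (α a) t)) (α (suc c)) m
            ≈⟨ eₙ-vars m (α-antitone c<a) α≤ ⟨
          eₙ R (suc j) (vars R x (α a) m) ∎
          where
          c<a : suc c ℕ.≤ a
          c<a = ≡.subst (suc c ℕ.≤_) (≡.sym (ℕ.+-suc c j)) (ℕ.m≤m+n (suc c) j)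
          m≤β : m ℕ.≤ β (suc c)
          m≤β = ℕ.+-cancelʳ-≤ (suc c) m _ (ℕ.≤-trans m≤ (proj₂ (hyp (suc c) (s≤s b≤c) c<a)))
          α≤ : α (suc c) ℕ.≤ α a ℕ.+ j
          α≤ = ℕ.+-cancelʳ-≤ (suc c) _ _ (ℕ.≤-trans (proj₁ (hyp (suc c) (s≤s b≤c) c<a))
            (ℕ.≤-reflexive (≡.trans (≡.cong (α a ℕ.+_) (≡.trans (ℕ.+-suc c j) (ℕ.+-comm (suc c) j)))
                                    (≡.sym (ℕ.+-assoc (α a) j (suc c))))))

        -- The smallest of the `suc j` distinct indices must exceed `α a`, so the largest would be
        -- at least `α a + suc j`.
        strict-vanish : ∀ {a} j c {m} → c ℕ.+ suc j ≡ a → m ℕ.< α a ℕ.+ suc j → strict (suc j) c m ≈ 0#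
        strict-vanish {a} zero c {m} ≡.refl m< = reflexive (sumFrom-empty _ (ℕ.≤-trans (ℕ.m⊓n≤m m (β (suc c)))
          (≡.subst₂ (λ u v → u ℕ.≤ α v) ≡.refl (ℕ.+-comm c 1)
            (ℕ.≤-pred (≡.subst (m ℕ.<_) (ℕ.+-comm (α a) 1) m<)))))
        strict-vanish {a} (suc j) c {m} eq m< = sumFrom-0 (m ⊓ β (suc c)) (λ {t} t< →
          trans (*-congˡ (strict-vanish j (suc c) (≡.trans (≡.sym (ℕ.+-suc c (suc j))) eq)
            (ℕ.<-≤-trans (ℕ.<-≤-trans t< (ℕ.m⊓n≤m m (β (suc c))))
              (ℕ.≤-pred (≡.subst (m ℕ.<_) (ℕ.+-suc (α a) (suc j)) m<))))) (zeroʳ _))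

        strictEntry≈e : ∀ a b →
          (+ a - + b ≤ + 0)
          ⊎ (+ β (suc b) - + α a < + a - + b)
          ⊎ (∀ i → suc b ℕ.≤ i → i ℕ.≤ a →
              (+ α i - + α a ≤ + a - + i) × (+ β (suc b) - + β i ≤ + i - + b - + 1)) →
          strictEntry b a ≈ e R (+ a - + b) (vars R x (α a) (β (suc b)))
        strictEntry≈e a b cond with a ℕ.≤? b
        -- Whichever alternative is given, both sides are 1 in degree 0 and 0 in negative degree.
        ... | yes a≤b = nonpositive (ℤ.i≤j⇒i-j≤0 (+≤+ a≤b))
          where
          nonpositive : ∀ {z c m ys} → z ≤ + 0 → strictℤ z c m ≈ e R z ys
          nonpositive {+ zero}    _         = refl
          nonpositive {+ suc _}   (+≤+ ())
          nonpositive { -[1+ _ ]} _         = refl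
        ... | no a≰b with j , ≡.refl ← ℕ.m≤n⇒∃[o]m+o≡n (ℕ.≰⇒> a≰b) = begin
          strictℤ (+ a - + b) b (β (suc b))
            ≡⟨ ≡.cong (λ z → strictℤ z b (β (suc b))) a-b ⟩
          strict (suc j) b (β (suc b))
            ≈⟨ cases cond ⟩
          eₙ R (suc j) (vars R x (α a) (β (suc b)))
            ≡⟨ ≡.cong (λ z → e R z (vars R x (α a) (β (suc b)))) a-b ⟨
          e R (+ a - + b) (vars R x (α a) (β (suc b))) ∎
          where
          a-b : + a - + b ≡ + suc j
          a-b = [1+a+i]-a≡1+i b j
          cases : _ → strict (suc j) b (β (suc b)) ≈ eₙ R (suc j) (vars R x (α a) (β (suc b)))
          cases (inj₁ a-b≤0) = contradiction (≡.subst (_≤ + 0) a-b a-b≤0) λ { (+≤+ ()) }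
          cases (inj₂ (inj₁ β-α<a-b)) =
            trans (strict-vanish j b (ℕ.+-suc b j) β<) (sym (eₙ-vars-vanish β<))
            where
            β< : β (suc b) ℕ.< α a ℕ.+ suc j
            β< = ℕ.+-cancelʳ-< b _ _ (ℕ.<-≤-trans (m-n<k-l⇒m+l<n+k (β (suc b)) (α a) a b β-α<a-b)
              (ℕ.≤-reflexive (≡.trans (≡.cong (λ z → α a ℕ.+ suc z) (ℕ.+-comm b j)) (≡.sym (ℕ.+-assoc (α a) (suc j) b)))))
          cases (inj₂ (inj₂ tight)) =
            strict≈eₙ (λ i b<i i≤a → m-n≤k-l⇒m+l≤n+k (α i) (α a) a i (proj₁ (tight i b<i i≤a)) ,
              m-n≤k-l⇒m+l≤n+k (β (suc b)) (β i) i (suc b) (≡.subst (+ β (suc b) - + β i ≤_) (i-m-1≡i-[1+m] (+ i) b) (proj₂ (tight i b<i i≤a)))) (suc j) b (ℕ.+-suc b j) ℕ.≤-refl ℕ.≤-refl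

theorem2p9 : {c ℓ : Level} (R : CommutativeRing c ℓ) (n : ℕ)
  (A B : Subset (suc n)) → ∣ A ∣ ≡ ∣ B ∣ →
  (α β : Fin n → ℕ) → IsPartition α → IsPartition β →
  ((i : Fin n) → α i ℕ.≤ β i) →
  ((a′ b′ : Fin (suc n)) → a′ ∈ ∁ A → b′ ∈ ∁ B →
    ((+ toℕ a′) - (+ toℕ b′) ≤ + 0)
    ⊎ ((+ part β (suc (toℕ b′))) - (+ part α (toℕ a′)) < (+ toℕ a′) - (+ toℕ b′))
    ⊎ ((i : ℕ) → suc (toℕ b′) ℕ.≤ i → i ℕ.≤ toℕ a′ →
        ((+ part α i) - (+ part α (toℕ a′)) ≤ (+ toℕ a′) - (+ i))
        × ((+ part β (suc (toℕ b′))) - (+ part β i) ≤ (+ i) - (+ toℕ b′) - + 1))) →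
  (x : ℕ → CommutativeRing.Carrier R) →
  CommutativeRing._≈_ R
    (det R (λ a b → h R ((+ toℕ b) - (+ toℕ a))
                        (vars R x (part α (suc (toℕ a))) (part β (toℕ b))))
         (elems A) (elems B))
    (det R (λ a′ b′ → e R ((+ toℕ a′) - (+ toℕ b′))
                        (vars R x (part α (toℕ a′)) (part β (suc (toℕ b′)))))
         (elems (∁ A)) (elems (∁ B)))
theorem2p9 R n A B ∣A∣≡∣B∣ α β αp βp α≤β cond x = begin
  det R _ (elems A) (elems B)
    ≈⟨ det≈D R _ (elems A) (elems B) ⟩
  D R (λ a b → H (toℕ a) (toℕ b)) (elems A) (elems B)
    ≈⟨ complementaryMinor R {suc n} H-upper N-upper
         (λ {_} {j} i<j → h-strict-inverse R x (part α) (part β) (part-antitone αp) (part-antitone βp)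
                            (suc n) i<j (toℕ<n j)) A B ∣A∣≡∣B∣ ⟩
  D R (λ a b → N (toℕ b) (toℕ a)) (elems (∁ A)) (elems (∁ B))
    -- Conditions (i)-(iii) enter here, entry by entry on the complements.
    ≈⟨ D-cong R
         (λ {a} {b} a∈∁A b∈∁B → strictEntry≈e R x (part α) (part β) (part-antitone αp) (part-antitone βp)
           (toℕ a) (toℕ b) (cond a b a∈∁A b∈∁B))
         (elems-∈ (∁ A)) (elems-∈ (∁ B)) ⟩
  D R _ (elems (∁ A)) (elems (∁ B))
    ≈⟨ det≈D R _ (elems (∁ A)) (elems (∁ B)) ⟨
  det R _ (elems (∁ A)) (elems (∁ B)) ∎
  where
  open SetoidReasoning (CommutativeRing.setoid R)
  H N : ℕ → ℕ → CommutativeRing.Carrier R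
  H = hEntry R x (part α) (part β)
  N = strictEntry R x (part α) (part β)
  H-upper : UpperUnitriangular R {suc n} (λ i j → H (toℕ i) (toℕ j))
  H-upper = record { diagonal = λ i → h-diagonal R x (part α) (part β) (toℕ i)
                   ; below    = h-below R x (part α) (part β) }
  N-upper : UpperUnitriangular R {suc n} (λ i j → N (toℕ i) (toℕ j))
  N-upper = record { diagonal = λ i → strict-diagonal R x (part α) (part β) (toℕ i)
                   ; below    = strict-below R x (part α) (part β) }
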